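{- For every integer $n\ge 1$, $$\mathrm{pf}_n(132,231,321)=C_n+(n-1)C_{n-1},$$ where $C_k=\frac{1}{k+1}\binom{2k}{k}$ is the $k$th Catalan number.
   Context: A Dyck path of semilength $n$ is a lattice path from $(0,0)$ to $(n,n)$ consisting of $n$ north steps $N=(0,1)$ and $n$ east steps $E=(1,0)$ that never goes below the line $y=x$. A parking function of size $n$ is a Dyck path of semilength $n$ whose $n$ north steps are labeled bijectively by $\{1,\dots,n\}$ so that whenever two north steps are consecutive in the path (one immediately following the other), the label of the later one is larger. For a parking function $p$ of size $n$, $\phi(p)$ is the permutation of $\{1,\dots,n\}$ (in one-line notation) obtained by reading the labels of the north steps in the order they occur along the path. A permutation $\pi$ of $\{1,\dots,n\}$ contains a permutation $\rho$ of $\{1,\dots,m\}$ if there are indices $1\le i_1<\cdots<i_m\le n$ such that $\pi_{i_a}\le\pi_{i_b}$ if and only if $\rho_a\le\rho_b$; otherwise $\pi$ avoids $\rho$. For permutations $\rho_1,\dots,\rho_r$, $\mathrm{pf}_n(\rho_1,\dots,\rho_r)$ denotes the number of parking functions $p$ of size $n$ such that $\phi(p)$ avoids each of $\rho_1,\dots,\rho_r$. -}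

module Defs where

open import Data.Fin.Base as Fin using (Fin; toℕ)
import Data.Fin.Properties as Fin
open import Data.List.Base using
  (List; []; _∷_; length; map; mapMaybe; filter; inits; lookup; allFin; cartesianProductWith)
open import Data.List.Membership.Propositional using (_∈_)
open import Data.List.Membership.Propositional.Properties using
  (∈-map⁺; ∈-map⁻; ∈-allFin; ∈-cartesianProductWith⁺; ∈-filter⁺; ∈-filter⁻)
open import Data.List.Relation.Unary.All as All using (All; []; _∷_)
open import Data.List.Relation.Unary.AllPairs.Core using ([]; _∷_)
open import Data.List.Relation.Unary.Any using (here; there)
import Data.List.Relation.Unary.All.Properties as All
open import Data.List.Relation.Unary.Linked as Linked using (Linked)
open import Data.List.Relation.Unary.Unique.Propositional using (Unique)
import Data.List.Relation.Unary.Unique.Propositional.Properties as Unique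
open import Data.Maybe.Base using (Maybe; just; nothing)
open import Data.Nat.Base using (ℕ; zero; suc; _+_; _*_; _≤_; _/_)
open import Data.Nat.Combinatorics using (_C_)
import Data.Nat.Properties as ℕ
open import Data.Product.Base using (∃; _×_; _,_; proj₂; uncurry)
open import Data.Unit.Base using (⊤)
open import Data.Vec.Base as Vec using (Vec; []; _∷_)
open import Function.Base using (_∘_)
open import Function.Bundles using (_⇔_; mk⇔; Equivalence)
open import Relation.Binary.PropositionalEquality using (_≡_; refl; cong; trans; sym)
open import Relation.Nullary.Decidable using (Dec; yes; ¬?; map′; _×-dec_; _→-dec_)
open import Relation.Nullary.Negation using (¬_)
import Data.List.Membership.DecPropositional as DecMembership
import Data.List.Relation.Unary.Unique.DecPropositional as DecUnique

-- The division is exact.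
catalan : ℕ → ℕ
catalan k = ((2 * k) C k) / suc k

------------------------------------------------------------------------
-- Labelled lattice paths

-- The label i : Fin n stands for the element toℕ i + 1 of {1,…,n}.
data Step (n : ℕ) : Set where
  N : Fin n → Step n
  E : Step n

Path : ℕ → Set
Path n = List (Step n)

module _ {n : ℕ} where

  northLabel : Step n → Maybe (Fin n)
  northLabel (N i) = just i
  northLabel E     = nothing

  labels : Path n → List (Fin n)
  labels = mapMaybe northLabel

  norths easts : Path n → ℕ
  norths = length ∘ labels

  easts []        = 0
  easts (N _ ∷ p) = easts p
  easts (E ∷ p)   = suc (easts p)

  -- The prefix q of a path ends at the lattice point (easts q , norths q).
  record IsDyck (p : Path n) : Set where
    field
      norths≡n   : norths p ≡ n
      easts≡n    : easts p ≡ n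
      neverBelow : All (λ q → easts q ≤ norths q) (inits p)

  Rising : Step n → Step n → Set
  Rising (N i) (N j) = i Fin.< j
  Rising (N _) E     = ⊤
  Rising E     _     = ⊤

  record IsParkingFunction (p : Path n) : Set where
    field
      isDyck           : IsDyck p
      labelsInjective  : Unique (labels p)
      labelsSurjective : ∀ i → i ∈ labels p
      labelsRise       : Linked Rising p

  φ : Path n → List ℕ
  φ p = map (suc ∘ toℕ) (labels p)

------------------------------------------------------------------------
-- Pattern containment, for permutations given by their one-line notation

Increasing : ∀ {n m} → Vec (Fin n) m → Set
Increasing is = ∀ a b → a Fin.< b → Vec.lookup is a Fin.< Vec.lookup is b

OrderIsomorphicAt : (π ρ : List ℕ) → Vec (Fin (length π)) (length ρ) → Set
OrderIsomorphicAt π ρ is = ∀ a b →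
  lookup π (Vec.lookup is a) ≤ lookup π (Vec.lookup is b) ⇔ lookup ρ a ≤ lookup ρ b

_Contains_ : List ℕ → List ℕ → Set
π Contains ρ = ∃ λ (is : Vec (Fin (length π)) (length ρ)) →
  Increasing is × OrderIsomorphicAt π ρ is

_Avoids_ : List ℕ → List ℕ → Set
π Avoids ρ = ¬ (π Contains ρ)

------------------------------------------------------------------------
-- Decidability

module _ {n : ℕ} where

  isDyck? : (p : Path n) → Dec (IsDyck p)
  isDyck? p = map′
    (λ (a , b , c) → record { norths≡n = a ; easts≡n = b ; neverBelow = c })
    (λ d → let open IsDyck d in norths≡n , easts≡n , neverBelow)
    ((norths p ℕ.≟ n) ×-dec (easts p ℕ.≟ n) ×-dec
     All.all? (λ q → easts q ℕ.≤? norths q) (inits p))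

  rising? : (s t : Step n) → Dec (Rising s t)
  rising? (N i) (N j) = i Fin.<? j
  rising? (N _) E     = yes _
  rising? E     _     = yes _

  isParkingFunction? : (p : Path n) → Dec (IsParkingFunction p)
  isParkingFunction? p = map′
    (λ (a , b , c , d) → record
      { isDyck = a ; labelsInjective = b ; labelsSurjective = c ; labelsRise = d })
    (λ q → let open IsParkingFunction q in
      isDyck , labelsInjective , labelsSurjective , labelsRise)
    (isDyck? p ×-dec DecUnique.unique? Fin._≟_ (labels p) ×-dec
     Fin.all? (λ i → DecMembership._∈?_ Fin._≟_ i (labels p)) ×-dec
     Linked.linked? rising? p)

anyVec? : ∀ {n m} {P : Vec (Fin n) m → Set} → (∀ v → Dec (P v)) → Dec (∃ P)
anyVec? {m = zero}  P? = map′ ([] ,_) (λ { ([] , p) → p }) (P? [])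
anyVec? {m = suc m} P? = map′
  (λ (i , v , p) → i ∷ v , p)
  (λ { (i ∷ v , p) → i , v , p })
  (Fin.any? λ i → anyVec? λ v → P? (i ∷ v))

_⇔-dec_ : {A B : Set} → Dec A → Dec B → Dec (A ⇔ B)
A? ⇔-dec B? = map′ (uncurry mk⇔) (λ e → let open Equivalence e in to , from)
  ((A? →-dec B?) ×-dec (B? →-dec A?))

_contains?_ : ∀ π ρ → Dec (π Contains ρ)
π contains? ρ = anyVec? λ is →
  Fin.all? (λ a → Fin.all? λ b →
    (a Fin.<? b) →-dec (Vec.lookup is a Fin.<? Vec.lookup is b))
  ×-dec
  Fin.all? (λ a → Fin.all? λ b →
    (lookup π (Vec.lookup is a) ℕ.≤? lookup π (Vec.lookup is b))
    ⇔-dec (lookup ρ a ℕ.≤? lookup ρ b))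

_avoids?_ : ∀ π ρ → Dec (π Avoids ρ)
π avoids? ρ = ¬? (π contains? ρ)

------------------------------------------------------------------------
-- Counting

words : {A : Set} → List A → ℕ → List (List A)
words xs zero    = [] ∷ []
words xs (suc k) = cartesianProductWith _∷_ xs (words xs k)

steps : ∀ n → List (Step n)
steps n = E ∷ map N (allFin n)

parkingFunctions : ∀ n → List (Path n)
parkingFunctions n = filter isParkingFunction? (words (steps n) (n + n))

pf : ℕ → List (List ℕ) → ℕ
pf n ρs = length (filter (λ p → All.all? (φ p avoids?_) ρs) (parkingFunctions n))

------------------------------------------------------------------------
-- The list parkingFunctions n has every parking function exactly once

words-unique : {A : Set} {xs : List A} → Unique xs → ∀ k → Unique (words xs k)
words-unique xs! zero    = [] ∷ []
words-unique xs! (suc k) =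
  Unique.cartesianProductWith⁺ _∷_ (λ { refl → refl , refl }) xs! (words-unique xs! k)

words-complete : {A : Set} {xs : List A} → (∀ x → x ∈ xs) →
                 ∀ w → w ∈ words xs (length w)
words-complete all []      = here refl
words-complete all (x ∷ w) = ∈-cartesianProductWith⁺ _∷_ (all x) (words-complete all w)

steps-unique : ∀ n → Unique (steps n)
steps-unique n =
  All.map⁺ (All.universal (λ _ ()) (allFin n))
  ∷ Unique.map⁺ (λ { refl → refl }) (Unique.allFin⁺ n)

steps-complete : ∀ {n} (s : Step n) → s ∈ steps n
steps-complete (N i) = there (∈-map⁺ N (∈-allFin i))
steps-complete E     = here refl

length≡norths+easts : ∀ {n} (p : Path n) → length p ≡ norths p + easts p
length≡norths+easts []        = refl
length≡norths+easts (N _ ∷ p) = cong suc (length≡norths+easts p)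
length≡norths+easts (E ∷ p)   =
  trans (cong suc (length≡norths+easts p)) (sym (ℕ.+-suc (norths p) (easts p)))

parkingFunctions-unique : ∀ n → Unique (parkingFunctions n)
parkingFunctions-unique n =
  Unique.filter⁺ isParkingFunction? (words-unique (steps-unique n) (n + n))

∈-parkingFunctions : ∀ {n} {p : Path n} → p ∈ parkingFunctions n ⇔ IsParkingFunction p
∈-parkingFunctions {n} {p} = mk⇔
  (λ p∈ → proj₂ (∈-filter⁻ isParkingFunction? {xs = words (steps n) (n + n)} p∈))
  (λ pf → ∈-filter⁺ isParkingFunction? (p∈words pf) pf)
  where
  p∈words : IsParkingFunction p → p ∈ words (steps n) (n + n)
  p∈words pf with words-complete steps-complete p
  ... | p∈ rewrite length≡norths+easts p
                 | IsDyck.norths≡n (IsParkingFunction.isDyck pf)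
                 | IsDyck.easts≡n (IsParkingFunction.isDyck pf) = p∈

{-# OPTIONS --safe #-}
-- A permutation avoids 132, 231 and 321 exactly when its entries after the first increase, so the
-- avoiders of size n = m + 1 are determined by their first entry l. For l = 1 the identity labels
-- every Dyck path. For l > 1 the only descent is at the start, so the path is N E followed by an
-- arbitrary Dyck path of semilength m. Dyck paths are counted by the ballot numbers
-- C(2a+h, a+h) − C(2a+h, a+h+1), where a is the number of north steps left and h the height.
module Submission where

open import Defs
open import Data.Empty using (⊥)
open import Data.Fin.Base as Fin using (Fin; zero; suc; toℕ; punchIn; punchOut)
import Data.Fin.Properties as Fin
open import Data.List.Base using
  (List; []; _∷_; _++_; length; map; inits; lookup; allFin; concatMap; filter)
open import Data.List.Properties using
  (length-++; length-map; length-tabulate; tabulate-lookup; ∷-injectiveʳ)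
open import Data.List.Membership.Propositional using (_∈_)
open import Data.List.Membership.Propositional.Properties using
  (∈-map⁺; ∈-map⁻; ∈-++⁺ˡ; ∈-++⁺ʳ; ∈-++⁻; ∈-concatMap⁺; ∈-concatMap⁻; ∈-allFin;
   ∈-filter⁺; ∈-filter⁻; ∈-lookup)
open import Data.List.Membership.Propositional.Properties.WithK using (unique∧set⇒bag)
open import Data.List.Relation.Binary.BagAndSetEquality using (∼bag⇒↭)
open import Data.List.Relation.Binary.Disjoint.Propositional using (Disjoint)
open import Data.List.Relation.Binary.Permutation.Propositional using (_↭_; ↭⇒↭ₛ)
open import Data.List.Relation.Binary.Permutation.Propositional.Properties using (↭-length)
open import Data.List.Relation.Binary.Pointwise using (Pointwise-≡⇒≡)
open import Data.List.Relation.Unary.All as All using (All; []; _∷_)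
import Data.List.Relation.Unary.All.Properties as All
open import Data.List.Relation.Unary.AllPairs as AllPairs using (AllPairs; []; _∷_)
import Data.List.Relation.Unary.AllPairs.Properties as AllPairs
open import Data.List.Relation.Unary.Any as Any using (here; there)
open import Data.List.Relation.Unary.Linked as Linked using (Linked; []; [-]; _∷_)
import Data.List.Relation.Unary.Linked.Properties as Linked
open import Data.List.Relation.Unary.Sorted.TotalOrder.Properties using (↗↭↗⇒≋)
open import Data.List.Relation.Unary.Unique.Propositional using (Unique)
import Data.List.Relation.Unary.Unique.Propositional.Properties as Unique
open import Data.Nat.Base using
  (ℕ; zero; suc; _+_; _*_; _∸_; _≤_; _<_; _≥_; z≤n; s≤s; s<s; z<s; s<s⁻¹)
open import Data.Nat.Combinatorics using
  (_C_; nCn≡1; nC1≡n; nCk≡nC[n∸k]; k>n⇒nCk≡0; nCk+nC[k+1]≡[n+1]C[k+1])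
open import Data.Nat.DivMod using (m*n/n≡m; /-congˡ)
open import Data.Nat.Properties
open import Data.Nat.Tactic.RingSolver using (solve-∀)
open import Data.Product.Base using (∃; _×_; _,_)
open import Data.Sum.Base using (_⊎_; inj₁; inj₂)
open import Data.Unit.Base using (tt)
open import Data.Vec.Base as Vec using ([]; _∷_)
open import Function.Base using (_∘_; id)
open import Function.Bundles using (_⇔_; mk⇔; Equivalence)
open import Relation.Binary.Definitions using (tri<; tri≈; tri>)
open import Relation.Binary.PropositionalEquality
open import Relation.Nullary.Decidable using (yes; no)
open import Relation.Nullary.Negation using (contradiction)

-- Duplicate-free and increasing lists

module _ {a} {A : Set a} where

  unique∧set⇒↭ : {xs ys : List A} → Unique xs → Unique ys → (∀ {x} → x ∈ xs ⇔ x ∈ ys) → xs ↭ ys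
  unique∧set⇒↭ xs! ys! xs∼ys = ∼bag⇒↭ (unique∧set⇒bag xs! ys! xs∼ys)

  lookup-AllPairs : ∀ {r} {R : A → A → Set r} {xs} → AllPairs R xs →
                    ∀ {i j} → i Fin.< j → R (lookup xs i) (lookup xs j)
  lookup-AllPairs (x~xs ∷ _)  {zero}  {suc j} _   = All.lookup x~xs (∈-lookup j)
  lookup-AllPairs (_ ∷ xs~) {suc i} {suc j} i<j = lookup-AllPairs xs~ (s<s⁻¹ i<j)

  length-concatMap-const : ∀ {b} {B : Set b} (f : A → List B) {c} → (∀ x → length (f x) ≡ c) →
                           ∀ xs → length (concatMap f xs) ≡ length xs * c
  length-concatMap-const f |f|≡c []       = refl
  length-concatMap-const f |f|≡c (x ∷ xs) =
    trans (length-++ (f x)) (cong₂ _+_ (|f|≡c x) (length-concatMap-const f |f|≡c xs))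

-- Strict increase excludes repetitions, so equal membership makes the lists permutations of each
-- other, and a list has only one sorted permutation.
increasing-ext : ∀ {n} {xs ys : List (Fin n)} → AllPairs Fin._<_ xs → AllPairs Fin._<_ ys →
                 (∀ {x} → x ∈ xs ⇔ x ∈ ys) → xs ≡ ys
increasing-ext {n} xs↗ ys↗ xs∼ys = Pointwise-≡⇒≡
  (↗↭↗⇒≋ (Fin.≤-totalOrder n) (sorted xs↗) (sorted ys↗)
    (↭⇒↭ₛ (unique∧set⇒↭ (unique xs↗) (unique ys↗) xs∼ys)))
  where
  unique : ∀ {zs : List (Fin n)} → AllPairs Fin._<_ zs → Unique zs
  unique = AllPairs.map Fin.<⇒≢
  sorted : ∀ {zs : List (Fin n)} → AllPairs Fin._<_ zs → Linked Fin._≤_ zs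
  sorted = Linked.map <⇒≤ ∘ Linked.AllPairs⇒Linked

-- Counting labelled walks

-- The height h is the excess of north steps over east steps before the walk.
walks : ∀ {n} → List (Fin n) → ℕ → List (Path n)
walks []       zero    = [] ∷ []
walks []       (suc h) = map (E ∷_) (walks [] h)
walks (l ∷ ls) zero    = map (N l ∷_) (walks ls 1)
walks (l ∷ ls) (suc h) = map (N l ∷_) (walks ls (suc (suc h))) ++ map (E ∷_) (walks (l ∷ ls) h)

pascal : ∀ n k → suc n C suc k ≡ n C k + n C suc k
pascal n k = sym (nCk+nC[k+1]≡[n+1]C[k+1] n k)

-- The absorption rule `(k+1) C(n,k+1) = (n-k) C(n,k)`, with `k C(n,k)` moved to the left so that no
-- truncated subtraction occurs. Induction on `n` through Pascal's rule.
[k+1]*nC[k+1]+k*nCk≡n*nCk : ∀ n k → suc k * (n C suc k) + k * (n C k) ≡ n * (n C k)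
[k+1]*nC[k+1]+k*nCk≡n*nCk n zero = begin
  (n C 1 + 0) + 0 ≡⟨ trans (+-identityʳ _) (+-identityʳ _) ⟩
  n C 1           ≡⟨ nC1≡n n ⟩
  n               ≡⟨ *-identityʳ n ⟨
  n * 1           ∎
  where open ≡-Reasoning
[k+1]*nC[k+1]+k*nCk≡n*nCk zero (suc k) = trans (cong₂ _+_ (*-zeroʳ k) (*-zeroʳ k)) refl
[k+1]*nC[k+1]+k*nCk≡n*nCk (suc n) (suc k) = begin
  suc (suc k) * (suc n C suc (suc k)) + suc k * (suc n C suc k)
    ≡⟨ cong₂ (λ u v → suc (suc k) * u + suc k * v) (pascal n (suc k)) (pascal n k) ⟩
  suc (suc k) * (y + z) + suc k * (x + y)
    ≡⟨ regroup k x y z ⟩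
  (suc (suc k) * z + suc k * y) + (suc k * y + k * x) + (x + y)
    ≡⟨ cong₂ (λ u v → u + v + (x + y))
         ([k+1]*nC[k+1]+k*nCk≡n*nCk n (suc k)) ([k+1]*nC[k+1]+k*nCk≡n*nCk n k) ⟩
  n * y + n * x + (x + y)
    ≡⟨ collect n x y ⟩
  suc n * (x + y)
    ≡⟨ cong (suc n *_) (pascal n k) ⟨
  suc n * (suc n C suc k) ∎
  where
  open ≡-Reasoning
  x = n C k
  y = n C suc k
  z = n C suc (suc k)
  regroup : ∀ k x y z → suc (suc k) * (y + z) + suc k * (x + y)
                      ≡ (suc (suc k) * z + suc k * y) + (suc k * y + k * x) + (x + y)
  regroup = solve-∀
  collect : ∀ n x y → n * y + n * x + (x + y) ≡ suc n * (x + y)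
  collect = solve-∀

module _ {n : ℕ} where

  -- The ballot number with its subtracted binomial moved to the left. Removing the first step of a
  -- walk mirrors Pascal's rule: one half of each split binomial belongs to the walks starting
  -- north, the other to those starting east.
  length-walks : ∀ (ls : List (Fin n)) h → let a = length ls in
    length (walks ls h) + (a + (a + h)) C suc (a + h) ≡ (a + (a + h)) C (a + h)
  length-walks []       zero    = refl
  length-walks []       (suc h) = begin
    length (map (E ∷_) (walks [] h)) + suc h C suc (suc h)
      ≡⟨ cong₂ _+_ (length-map (E ∷_) (walks [] h)) (pascal h (suc h)) ⟩
    length (walks [] h) + (h C suc h + h C suc (suc h))
      ≡⟨ cong (λ u → length (walks [] h) + (h C suc h + u)) (k>n⇒nCk≡0 (m≤n⇒m≤1+n (n<1+n h))) ⟩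
    length (walks [] h) + (h C suc h + 0)
      ≡⟨ cong (length (walks [] h) +_) (+-identityʳ _) ⟩
    length (walks [] h) + h C suc h
      ≡⟨ length-walks [] h ⟩
    h C h
      ≡⟨ trans (nCn≡1 h) (sym (nCn≡1 (suc h))) ⟩
    suc h C suc h ∎
    where open ≡-Reasoning
  length-walks (l ∷ ls) zero    = begin
    length (map (N l ∷_) (walks ls 1)) + suc M C suc (suc (a + 0))
      ≡⟨ cong₂ _+_ (length-map (N l ∷_) (walks ls 1)) (pascal M (suc (a + 0))) ⟩
    w + (M C suc (a + 0) + M C suc (suc (a + 0)))
      ≡⟨ swap w (M C suc (a + 0)) (M C suc (suc (a + 0))) ⟩
    M C suc (a + 0) + (w + M C suc (suc (a + 0)))
      ≡⟨ cong (M C suc (a + 0) +_) ih ⟩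
    M C suc (a + 0) + M C suc (a + 0)
      ≡⟨ cong (_+ M C suc (a + 0)) symm ⟩
    M C (a + 0) + M C suc (a + 0)
      ≡⟨ pascal M (a + 0) ⟨
    suc M C suc (a + 0) ∎
    where
    open ≡-Reasoning
    a = length ls
    w = length (walks ls 1)
    M = a + suc (a + 0)
    ih : w + M C suc (suc (a + 0)) ≡ M C suc (a + 0)
    ih = subst (λ u → w + (a + u) C suc u ≡ (a + u) C u) (+-suc a 0) (length-walks ls 1)
    -- At height zero no walk starts east. The two binomials that such walks would contribute
    -- cancel, because `M` is `2a+1` and its two middle binomials agree.
    symm : M C suc (a + 0) ≡ M C (a + 0)
    symm = trans (nCk≡nC[n∸k] (m≤n+m (suc (a + 0)) a))
      (cong (M C_) (trans (m+n∸n≡m a (suc (a + 0))) (sym (+-identityʳ a))))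
    swap : ∀ x y z → x + (y + z) ≡ y + (x + z)
    swap = solve-∀
  length-walks (l ∷ ls) (suc h) = begin
    length (wsᴺ ++ wsᴱ) + suc M C suc (suc k)
      ≡⟨ cong₂ _+_ (length-++ wsᴺ) (pascal M (suc k)) ⟩
    (length wsᴺ + length wsᴱ) + (M C suc k + M C suc (suc k))
      ≡⟨ cong₂ (λ i j → (i + j) + (M C suc k + M C suc (suc k)))
           (length-map (N l ∷_) (walks ls (suc (suc h)))) (length-map (E ∷_) (walks (l ∷ ls) h)) ⟩
    (u + v) + (M C suc k + M C suc (suc k))
      ≡⟨ interchange u v (M C suc k) (M C suc (suc k)) ⟩
    (v + M C suc k) + (u + M C suc (suc k))
      ≡⟨ cong₂ _+_ (reindex (length-walks (l ∷ ls) h)) ih ⟩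
    M C k + M C suc k
      ≡⟨ pascal M k ⟨
    suc M C suc k ∎
    where
    open ≡-Reasoning
    a = length ls
    k = a + suc h
    M = a + suc k
    wsᴺ = map (N l ∷_) (walks ls (suc (suc h)))
    wsᴱ = map (E ∷_) (walks (l ∷ ls) h)
    u = length (walks ls (suc (suc h)))
    v = length (walks (l ∷ ls) h)
    -- After either first step `2a+h+2` steps remain, so both induction hypotheses have upper index
    -- `M`; only the places of the `suc`s differ.
    ih : u + M C suc (suc k) ≡ M C suc k
    ih = subst (λ j → u + (a + j) C suc j ≡ (a + j) C j) (+-suc a (suc h))
      (length-walks ls (suc (suc h)))
    reindex : let j = suc (a + h) in v + suc (a + j) C suc j ≡ suc (a + j) C j →
              v + M C suc k ≡ M C k
    reindex = subst (λ i → v + i C suc k ≡ i C k) (sym (+-suc a k)) ∘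
      subst (λ j → v + suc (a + j) C suc j ≡ suc (a + j) C j) (sym (+-suc a h))
    interchange : ∀ u v x y → (u + v) + (x + y) ≡ (v + x) + (u + y)
    interchange = solve-∀

  -- `catalan` is defined by a division, so the point is that `w * suc a` equals the central
  -- binomial exactly.
  length-walks₀ : (ls : List (Fin n)) → length (walks ls 0) ≡ catalan (length ls)
  length-walks₀ ls = sym (trans (/-congˡ (sym w*[a+1]≡c)) (m*n/n≡m w (suc a)))
    where
    open ≡-Reasoning
    a = length ls
    w = length (walks ls 0)
    c = (2 * a) C a
    d = (2 * a) C suc a
    w+d≡c : w + d ≡ c
    w+d≡c = subst (λ j → w + (a + (a + 0)) C suc j ≡ (a + (a + 0)) C j) (+-identityʳ a)
      (length-walks ls 0)
    rearrange : ∀ a w d → w * suc a + (suc a * d + a * (w + d)) ≡ (w + d) + 2 * a * (w + d)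
    rearrange = solve-∀
    w*[a+1]≡c : w * suc a ≡ c
    -- Adding `2 * a * c` to both sides lets the absorption rule at row `2a`, column `a` replace it
    -- by `suc a * d + a * c`; the rest is linear once `c` is written as `w + d`.
    w*[a+1]≡c = +-cancelʳ-≡ (2 * a * c) (w * suc a) c (begin
      w * suc a + 2 * a * c
        ≡⟨ cong (w * suc a +_) ([k+1]*nC[k+1]+k*nCk≡n*nCk (2 * a) a) ⟨
      w * suc a + (suc a * d + a * c)
        ≡⟨ cong (λ x → w * suc a + (suc a * d + a * x)) w+d≡c ⟨
      w * suc a + (suc a * d + a * (w + d))
        ≡⟨ rearrange a w d ⟩
      (w + d) + 2 * a * (w + d)
        ≡⟨ cong (λ x → x + 2 * a * x) w+d≡c ⟩
      c + 2 * a * c ∎)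

-- Permutations avoiding the three patterns

forbidden : List (List ℕ)
forbidden = (1 ∷ 3 ∷ 2 ∷ []) ∷ (2 ∷ 3 ∷ 1 ∷ []) ∷ (3 ∷ 2 ∷ 1 ∷ []) ∷ []

SameOrder : (x y u v : ℕ) → Set
SameOrder x y u v = (x < y × u < v) ⊎ (y < x × v < u)

-- Pairs with `a < b` suffice: a strict comparison on both sides decides `≤` in either direction,
-- and equal positions are trivial.
sameOrder⇒≤⇔≤ : ∀ {n} (f g : Fin n → ℕ) →
  (∀ a b → a Fin.< b → SameOrder (f a) (f b) (g a) (g b)) → ∀ a b → f a ≤ f b ⇔ g a ≤ g b
sameOrder⇒≤⇔≤ f g same a b with Fin.<-cmp a b
... | tri≈ _ refl _ = mk⇔ (λ _ → ≤-refl) (λ _ → ≤-refl)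
... | tri< a<b _ _ with same a b a<b
...   | inj₁ (f< , g<) = mk⇔ (λ _ → <⇒≤ g<) (λ _ → <⇒≤ f<)
...   | inj₂ (f> , g>) = mk⇔ (λ f≤ → contradiction f≤ (<⇒≱ f>)) (λ g≤ → contradiction g≤ (<⇒≱ g>))
sameOrder⇒≤⇔≤ f g same a b | tri> _ _ b<a with same b a b<a
...   | inj₁ (f> , g>) = mk⇔ (λ f≤ → contradiction f≤ (<⇒≱ f>)) (λ g≤ → contradiction g≤ (<⇒≱ g>))
...   | inj₂ (f< , g<) = mk⇔ (λ _ → <⇒≤ g<) (λ _ → <⇒≤ f<)

contains-from-head : ∀ {x xs r s t} {i j : Fin (length xs)} → i Fin.< j →
  SameOrder x (lookup xs i) r s → SameOrder x (lookup xs j) r t →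
  SameOrder (lookup xs i) (lookup xs j) s t → (x ∷ xs) Contains (r ∷ s ∷ t ∷ [])
contains-from-head {x} {xs} {r} {s} {t} {i} {j} i<j xy xz yz = is , increasing ,
  sameOrder⇒≤⇔≤ (lookup (x ∷ xs) ∘ Vec.lookup is) (lookup (r ∷ s ∷ t ∷ [])) same
  where
  is = zero ∷ suc i ∷ suc j ∷ []
  increasing : Increasing is
  increasing zero             (suc zero)       _ = z<s
  increasing zero             (suc (suc zero)) _ = z<s
  increasing (suc zero)       (suc (suc zero)) _ = s<s i<j
  increasing (suc zero)       (suc zero)       (s≤s ())
  increasing (suc (suc zero)) (suc zero)       (s≤s ())
  increasing (suc (suc zero)) (suc (suc zero)) (s≤s (s≤s ()))
  same : ∀ a b → a Fin.< b →
         SameOrder (lookup (x ∷ xs) (Vec.lookup is a)) (lookup (x ∷ xs) (Vec.lookup is b))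
                   (lookup (r ∷ s ∷ t ∷ []) a) (lookup (r ∷ s ∷ t ∷ []) b)
  same zero             (suc zero)       _ = xy
  same zero             (suc (suc zero)) _ = xz
  same (suc zero)       (suc (suc zero)) _ = yz
  same (suc zero)       (suc zero)       (s≤s ())
  same (suc (suc zero)) (suc zero)       (s≤s ())
  same (suc (suc zero)) (suc (suc zero)) (s≤s (s≤s ()))

-- A descent y > z after the first entry x forms 132, 231 or 321 with x, according to the rank of x.
avoids⇒tail-increasing : ∀ {x xs} → Unique (x ∷ xs) → All ((x ∷ xs) Avoids_) forbidden →
                           AllPairs _<_ xs
avoids⇒tail-increasing {x} {xs} (x∉xs ∷ xs!) (¬132 ∷ ¬231 ∷ ¬321 ∷ []) =
  subst (AllPairs _<_) (tabulate-lookup xs) (AllPairs.tabulate⁺-< λ {i} {j} → ascent i j)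
  where
  ascent : ∀ i j → i Fin.< j → lookup xs i < lookup xs j
  ascent i j i<j with <-cmp (lookup xs i) (lookup xs j)
  ... | tri< y<z _ _ = y<z
  ... | tri≈ _ y≡z _ = contradiction y≡z (lookup-AllPairs xs! i<j)
  ... | tri> _ _ z<y with <-cmp x (lookup xs i) | <-cmp x (lookup xs j)
  ...   | tri≈ _ x≡y _ | _            = contradiction x≡y (All.lookup x∉xs (∈-lookup i))
  ...   | _            | tri≈ _ x≡z _ = contradiction x≡z (All.lookup x∉xs (∈-lookup j))
  ...   | tri< x<y _ _ | tri< x<z _ _ = contradiction
    (contains-from-head i<j (inj₁ (x<y , s≤s z<s)) (inj₁ (x<z , ≤-refl)) (inj₂ (z<y , ≤-refl))) ¬132
  ...   | tri< x<y _ _ | tri> _ _ z<x = contradiction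
    (contains-from-head i<j (inj₁ (x<y , ≤-refl)) (inj₂ (z<x , ≤-refl)) (inj₂ (z<y , s≤s z<s))) ¬231
  ...   | tri> _ _ y<x | tri< x<z _ _ = contradiction (<-trans x<z z<y) (<-asym y<x)
  ...   | tri> _ _ y<x | tri> _ _ z<x = contradiction
    (contains-from-head i<j (inj₂ (y<x , ≤-refl)) (inj₂ (z<x , s≤s z<s)) (inj₂ (z<y , ≤-refl))) ¬321

-- The last two entries of an occurrence come after another entry, hence lie in the increasing tail,
-- where they cannot form the descent from `s` to `t`.
tail-increasing⇒avoids-descent : ∀ {x xs r s t} → AllPairs _<_ xs → t < s →
                                 (x ∷ xs) Avoids (r ∷ s ∷ t ∷ [])
tail-increasing⇒avoids-descent xs↗ t<s (i ∷ j ∷ k ∷ [] , is↗ , iso)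
  -- Exposing these inequalities rules out position `zero` for the second and third indices.
  with is↗ zero (suc zero) z<s | is↗ (suc zero) (suc (suc zero)) (s≤s z<s)
tail-increasing⇒avoids-descent xs↗ t<s (i ∷ suc j ∷ suc k ∷ [] , is↗ , iso) | _ | j<k =
  <⇒≱ t<s (Equivalence.to (iso (suc zero) (suc (suc zero))) (<⇒≤ (lookup-AllPairs xs↗ (s<s⁻¹ j<k))))

tail-increasing⇒avoids : ∀ {x xs} → AllPairs _<_ xs → All ((x ∷ xs) Avoids_) forbidden
tail-increasing⇒avoids xs↗ =
  tail-increasing⇒avoids-descent xs↗ ≤-refl ∷
  tail-increasing⇒avoids-descent xs↗ (s≤s z<s) ∷
  tail-increasing⇒avoids-descent xs↗ ≤-refl ∷ []

others : ∀ {m} → Fin (suc m) → List (Fin (suc m))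
others {m} l = map (punchIn l) (allFin m)

module _ {m : ℕ} where

  length-others : (l : Fin (suc m)) → length (others l) ≡ m
  length-others l = trans (length-map (punchIn l) (allFin m)) (length-tabulate id)

  others-increasing : (l : Fin (suc m)) → AllPairs Fin._<_ (others l)
  others-increasing l = AllPairs.map⁺ (AllPairs.tabulate⁺-< λ {i} {j} i<j →
    ≤∧≢⇒< (Fin.punchIn-mono-≤ l i j (<⇒≤ i<j))
           (Fin.<⇒≢ i<j ∘ Fin.punchIn-injective l i j ∘ Fin.toℕ-injective))

  ∈-others : ∀ {l j : Fin (suc m)} → l ≢ j → j ∈ others l
  ∈-others {l} l≢j = subst (_∈ others l) (Fin.punchIn-punchOut l≢j)
    (∈-map⁺ (punchIn l) (∈-allFin (punchOut l≢j)))

  ≢-others : (l : Fin (suc m)) → All (l ≢_) (others l)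
  ≢-others l = All.map⁺ (All.universal (λ j → Fin.punchInᵢ≢i l j ∘ sym) (allFin m))

  -- This is why an avoider is determined by its first entry: the remaining entries have a fixed set
  -- and must be sorted.
  increasing⇒others : ∀ {l : Fin (suc m)} {xs} → Unique (l ∷ xs) → (∀ i → i ∈ l ∷ xs) →
                      AllPairs Fin._<_ xs → xs ≡ others l
  increasing⇒others {l} {xs} (l∉xs ∷ _) l∷xs-full xs↗ = increasing-ext xs↗ (others-increasing l)
    (mk⇔ (∈-others ∘ All.lookup l∉xs)
         λ j∈ → Any.tail (All.lookup (≢-others l) j∈ ∘ sym) (l∷xs-full _))

-- Parking functions with avoiding labels

module _ {n : ℕ} where

  -- A stepwise form of the Dyck condition, fit for induction: the index is the current height above
  -- the diagonal, `east` needs it to be positive, and the walk must end at height zero.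
  data Walk : ℕ → Path n → Set where
    end   : Walk 0 []
    north : ∀ {h i p} → Walk (suc h) p → Walk h (N i ∷ p)
    east  : ∀ {h p} → Walk h p → Walk (suc h) (E ∷ p)

  NeverBelowFrom : ℕ → Path n → Set
  NeverBelowFrom h p = All (λ q → easts q ≤ h + norths q) (inits p)

  walk⁺ : ∀ h p → NeverBelowFrom h p → easts p ≡ h + norths p → Walk h p
  walk⁺ zero    []        _            _  = end
  walk⁺ h       (N i ∷ p) (_ ∷ above)  eq = north (walk⁺ (suc h) p
    (All.map (λ {q} → subst (easts q ≤_) (+-suc h (norths q))) (All.map⁻ above))
    (trans eq (+-suc h (norths p))))
  -- The prefix made of this single east step would already be below the diagonal.
  walk⁺ zero    (E ∷ p)   (_ ∷ () ∷ _) eq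
  walk⁺ (suc h) (E ∷ p)   (_ ∷ above)  eq =
    east (walk⁺ h p (All.map ≤-pred (All.map⁻ above)) (suc-injective eq))

  walk⁻ : ∀ {h p} → Walk h p → NeverBelowFrom h p × easts p ≡ h + norths p
  walk⁻ end = (z≤n ∷ []) , refl
  walk⁻ (north {h} {p = p} w) with walk⁻ w
  ... | above , eq =
    z≤n ∷ All.map⁺ (All.map (λ {q} → subst (easts q ≤_) (sym (+-suc h (norths q)))) above) ,
    trans eq (sym (+-suc h (norths p)))
  walk⁻ (east w) with walk⁻ w
  ... | above , eq = z≤n ∷ All.map⁺ (All.map s≤s above) , cong suc eq

  isDyck⇒walk : ∀ {p : Path n} → IsDyck p → Walk 0 p
  isDyck⇒walk {p} d = walk⁺ 0 p neverBelow (trans easts≡n (sym norths≡n))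
    where open IsDyck d

  walk⇒isDyck : ∀ {p : Path n} → Walk 0 p → norths p ≡ n → IsDyck p
  walk⇒isDyck w norths≡n with walk⁻ w
  ... | above , eq = record { norths≡n = norths≡n ; easts≡n = trans eq norths≡n ; neverBelow = above }

  ∈-walks⁺ : ∀ {h p} → Walk h p → p ∈ walks (labels p) h
  ∈-walks⁺ end = here refl
  ∈-walks⁺ (north {zero}  w) = ∈-map⁺ (N _ ∷_) (∈-walks⁺ w)
  ∈-walks⁺ (north {suc h} w) = ∈-++⁺ˡ (∈-map⁺ (N _ ∷_) (∈-walks⁺ w))
  -- `walks` offers only the east step when no labels remain, and lists it second otherwise, so the
  -- remaining labels must be inspected.
  ∈-walks⁺ (east {p = p}  w) with labels p | ∈-walks⁺ w
  ... | []     | p∈ = ∈-map⁺ (E ∷_) p∈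
  ... | l ∷ ls | p∈ = ∈-++⁺ʳ (map (N l ∷_) (walks ls _)) (∈-map⁺ (E ∷_) p∈)

  ∈-walks⁻ : ∀ (ls : List (Fin n)) h {p} → p ∈ walks ls h → Walk h p × labels p ≡ ls
  ∈-walks⁻ []       zero    (here refl) = end , refl
  ∈-walks⁻ []       (suc h) p∈ with ∈-map⁻ (E ∷_) p∈
  ... | _ , q∈ , refl = let w , eq = ∈-walks⁻ [] h q∈ in east w , eq
  ∈-walks⁻ (l ∷ ls) zero    p∈ with ∈-map⁻ (N l ∷_) p∈
  ... | _ , q∈ , refl = let w , eq = ∈-walks⁻ ls 1 q∈ in north w , cong (l ∷_) eq
  ∈-walks⁻ (l ∷ ls) (suc h) p∈ with ∈-++⁻ (map (N l ∷_) (walks ls (suc (suc h)))) p∈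
  ... | inj₁ p∈ᴺ with ∈-map⁻ (N l ∷_) p∈ᴺ
  ...   | _ , q∈ , refl = let w , eq = ∈-walks⁻ ls (suc (suc h)) q∈ in north w , cong (l ∷_) eq
  ∈-walks⁻ (l ∷ ls) (suc h) p∈ | inj₂ p∈ᴱ with ∈-map⁻ (E ∷_) p∈ᴱ
  ...   | _ , q∈ , refl = let w , eq = ∈-walks⁻ (l ∷ ls) h q∈ in east w , eq

  walks-unique : ∀ (ls : List (Fin n)) h → Unique (walks ls h)
  walks-unique []       zero    = [] ∷ []
  walks-unique []       (suc h) = Unique.map⁺ ∷-injectiveʳ (walks-unique [] h)
  walks-unique (l ∷ ls) zero    = Unique.map⁺ ∷-injectiveʳ (walks-unique ls 1)
  walks-unique (l ∷ ls) (suc h) = Unique.++⁺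
    (Unique.map⁺ ∷-injectiveʳ (walks-unique ls (suc (suc h))))
    (Unique.map⁺ ∷-injectiveʳ (walks-unique (l ∷ ls) h))
    λ (p∈ᴺ , p∈ᴱ) → N≢E (∈-map⁻ (N l ∷_) p∈ᴺ) (∈-map⁻ (E ∷_) p∈ᴱ)
    where
    N≢E : ∀ {p ps qs} → ∃ (λ q → q ∈ ps × p ≡ N l ∷ q) → ∃ (λ q → q ∈ qs × p ≡ E ∷ q) → ⊥
    N≢E (_ , _ , refl) (_ , _ , ())

  -- Only adjacent north steps are constrained, so increasing labels are legal on a path of any
  -- shape.
  labels-increasing⇒rising : ∀ (p : Path n) → AllPairs Fin._<_ (labels p) → Linked Rising p
  labels-increasing⇒rising []              _               = []
  labels-increasing⇒rising (N i ∷ [])      _               = [-]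
  labels-increasing⇒rising (N i ∷ N j ∷ p) ((i<j ∷ _) ∷ ↗) = i<j ∷ labels-increasing⇒rising (N j ∷ p) ↗
  labels-increasing⇒rising (N i ∷ E ∷ p)   (_ ∷ ↗)         = tt ∷ labels-increasing⇒rising (E ∷ p) ↗
  labels-increasing⇒rising (E ∷ [])        _               = [-]
  labels-increasing⇒rising (E ∷ s ∷ p)     ↗               = tt ∷ labels-increasing⇒rising (s ∷ p) ↗

-- Listing the avoiders by their first label

module _ {m : ℕ} where

  IsAvoider : Path (suc m) → Set
  IsAvoider p = IsParkingFunction p × All (φ p Avoids_) forbidden

  avoider-labels : ∀ {l p} → IsAvoider (N l ∷ p) → labels p ≡ others l
  avoider-labels (isPF , avoids) = increasing⇒others labelsInjective labelsSurjective
    (AllPairs.map s<s⁻¹ (AllPairs.map⁻ (avoids⇒tail-increasing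
      (Unique.map⁺ (Fin.toℕ-injective ∘ suc-injective) labelsInjective) avoids)))
    where open IsParkingFunction isPF

  -- `Linked Rising p` stays a hypothesis because it depends on the shape of the path: if `l` is not
  -- the smallest label, the labels start with a descent.
  isAvoider : ∀ {l p} → Walk 0 p → labels p ≡ l ∷ others l → Linked Rising p → IsAvoider p
  isAvoider {l} {p} w eq rise = record
    { isDyck           = walk⇒isDyck w (trans (cong length eq) (cong suc (length-others l)))
    ; labelsInjective  = subst Unique (sym eq)
        (≢-others l ∷ AllPairs.map Fin.<⇒≢ (others-increasing l))
    ; labelsSurjective = λ i → subst (i ∈_) (sym eq) (∈l∷others i)
    ; labelsRise       = rise
    } , subst (λ ls → All (map (suc ∘ toℕ) ls Avoids_) forbidden) (sym eq)
          (tail-increasing⇒avoids (AllPairs.map⁺ (AllPairs.map s<s (others-increasing l))))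
    where
    ∈l∷others : ∀ i → i ∈ l ∷ others l
    ∈l∷others i with i Fin.≟ l
    ... | yes i≡l = here i≡l
    ... | no  i≢l = there (∈-others (i≢l ∘ sym))

  -- If the first label is not the smallest, the smallest comes right after it. Matching on `k`
  -- makes `m` a successor, which lets `others` unfold.
  head-others-suc : ∀ (k : Fin m) {j js} → j ∷ js ≡ others (suc k) → j ≡ zero
  head-others-suc zero    refl = refl
  head-others-suc (suc k) refl = refl

module _ (m : ℕ) where

  identity : List (Fin (suc m))
  identity = zero ∷ others zero

  detour : Fin m → Path (suc m) → Path (suc m)
  detour k w = N (suc k) ∷ E ∷ w

  -- The descent after the first label `suc k` forces an east step, which returns to the diagonal;
  -- hence the remainder starts again at height zero.
  detours : Fin m → List (Path (suc m))
  detours k = map (detour k) (walks (others (suc k)) 0)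

  avoiders : List (Path (suc m))
  avoiders = walks identity 0 ++ concatMap detours (allFin m)

  length-avoiders : length avoiders ≡ catalan (suc m) + m * catalan m
  length-avoiders = begin
    length avoiders
      ≡⟨ length-++ (walks identity 0) ⟩
    length (walks identity 0) + length (concatMap detours (allFin m))
      ≡⟨ cong₂ _+_ (length-walks₀ identity)
           (length-concatMap-const detours length-detours (allFin m)) ⟩
    catalan (length identity) + length (allFin m) * catalan m
      ≡⟨ cong₂ (λ i j → catalan i + j * catalan m)
           (cong suc (length-others {m} zero)) (length-tabulate {n = m} id) ⟩
    catalan (suc m) + m * catalan m ∎
    where
    open ≡-Reasoning
    length-detours : ∀ k → length (detours k) ≡ catalan m
    length-detours k = begin
      length (detours k)                 ≡⟨ length-map (detour k) (walks (others (suc k)) 0) ⟩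
      length (walks (others (suc k)) 0)  ≡⟨ length-walks₀ (others (suc k)) ⟩
      catalan (length (others (suc k)))  ≡⟨ cong catalan (length-others (suc k)) ⟩
      catalan m                          ∎

  ∈-detours⁻ : ∀ {k p} → p ∈ detours k →
               ∃ λ w → Walk 0 w × labels w ≡ others (suc k) × p ≡ detour k w
  ∈-detours⁻ {k} p∈ with ∈-map⁻ (detour k) p∈
  ... | w , w∈ , refl = let walk , eq = ∈-walks⁻ (others (suc k)) 0 w∈ in w , walk , eq , refl

  -- The first label separates the pieces: it is `zero` in the walks labelled by `identity` and
  -- `suc k` in `detours k`.
  avoiders-unique : Unique avoiders
  avoiders-unique = Unique.++⁺ (walks-unique identity 0)
    (Unique.concat⁺
      (All.map⁺ (All.universal detours-unique (allFin m)))
      (AllPairs.map⁺ (AllPairs.map (λ {k} {l} k≢l {p} → detours-disjoint {k} {l} k≢l {p})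
        (Unique.allFin⁺ m))))
    λ (p∈ , p∈ᵈ) → walks-detours-disjoint p∈
      (Any.satisfied (∈-concatMap⁻ detours {xs = allFin m} p∈ᵈ))
    where
    detours-unique : ∀ k → Unique (detours k)
    detours-unique k = Unique.map⁺ (∷-injectiveʳ ∘ ∷-injectiveʳ) (walks-unique (others (suc k)) 0)
    detours-disjoint : ∀ {k l} → k ≢ l → Disjoint (detours k) (detours l)
    detours-disjoint k≢l (p∈k , p∈l) with ∈-detours⁻ p∈k | ∈-detours⁻ p∈l
    ... | _ , _ , _ , refl | _ , _ , _ , refl = k≢l refl
    walks-detours-disjoint : ∀ {p} → p ∈ walks identity 0 → ∃ (λ k → p ∈ detours k) → ⊥
    walks-detours-disjoint p∈ (k , p∈ᵈ) with ∈-detours⁻ {k} p∈ᵈ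
    ... | w , _ , _ , refl with ∈-walks⁻ identity 0 p∈
    ...   | _ , ()

  ∈-avoiders⁻ : ∀ {p} → p ∈ avoiders → IsAvoider p
  ∈-avoiders⁻ {p} p∈ with ∈-++⁻ (walks identity 0) p∈
  ... | inj₁ p∈ʷ = let w , eq = ∈-walks⁻ identity 0 p∈ʷ in
    isAvoider w eq (labels-increasing⇒rising p (subst (AllPairs Fin._<_) (sym eq) zero∷others↗))
    where
    zero∷others↗ : AllPairs Fin._<_ (zero ∷ others zero)
    zero∷others↗ = All.map⁺ (All.universal (λ _ → z<s) (allFin m)) ∷ others-increasing zero
  ... | inj₂ p∈ᵈ with Any.satisfied (∈-concatMap⁻ detours {xs = allFin m} p∈ᵈ)
  ...   | k , p∈ᵏ with ∈-detours⁻ {k} p∈ᵏ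
  ...     | w , walk , eq , refl = isAvoider (north (east walk)) (cong (suc k ∷_) eq)
    -- The east step interrupts the only descent, and the labels after it increase.
    (tt ∷ labels-increasing⇒rising (E ∷ w)
      (subst (AllPairs Fin._<_) (sym eq) (others-increasing (suc k))))

  ∈-avoiders⁺ : ∀ {p} → IsAvoider p → p ∈ avoiders
  ∈-avoiders⁺ {p} av@(isPF , _)
    with isDyck⇒walk (IsParkingFunction.isDyck isPF) | IsDyck.norths≡n (IsParkingFunction.isDyck isPF)
  ... | end | ()
  ... | walk@(north {i = zero} _) | _ =
    ∈-++⁺ˡ (subst (λ ls → p ∈ walks ls 0) (cong (zero ∷_) (avoider-labels av)) (∈-walks⁺ walk))
  ... | north {i = suc k} (east {p = w} walk) | _ = ∈-++⁺ʳ (walks identity 0)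
    (∈-concatMap⁺ detours (Any.map (λ { refl → w∈ }) (∈-allFin k)))
    where
    w∈ : detour k w ∈ detours k
    w∈ = ∈-map⁺ (detour k) (subst (λ ls → w ∈ walks ls 0) (avoider-labels av) (∈-walks⁺ walk))
  -- A second north step at once would carry the label `zero`, below the label `suc k` just before
  -- it.
  ... | north {i = suc k} (north {i = j} _) | _ =
    contradiction (head-others-suc k (avoider-labels av))
      λ { refl → contradiction (Linked.head (IsParkingFunction.labelsRise isPF)) λ () }

theorem14 : (n : ℕ) → n ≥ 1 →
    pf n ((1 ∷ 3 ∷ 2 ∷ []) ∷ (2 ∷ 3 ∷ 1 ∷ []) ∷ (3 ∷ 2 ∷ 1 ∷ []) ∷ [])
    ≡ catalan n + (n ∸ 1) * catalan (n ∸ 1)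
theorem14 (suc m) _ = trans
  -- Both lists are free of repetitions and have the same members, hence the same length.
  (↭-length (unique∧set⇒↭
    (Unique.filter⁺ avoids-forbidden? (parkingFunctions-unique (suc m))) (avoiders-unique m)
    (mk⇔ (∈-avoiders⁺ m ∘ from-filter) (to-filter ∘ ∈-avoiders⁻ m))))
  (length-avoiders m)
  where
  avoids-forbidden? = λ (p : Path (suc m)) → All.all? (φ p avoids?_) forbidden
  from-filter : ∀ {p} → p ∈ filter avoids-forbidden? (parkingFunctions (suc m)) → IsAvoider p
  from-filter p∈ =
    let p∈pf , avoids = ∈-filter⁻ avoids-forbidden? {xs = parkingFunctions (suc m)} p∈
    in Equivalence.to ∈-parkingFunctions p∈pf , avoids
  to-filter : ∀ {p} → IsAvoider p → p ∈ filter avoids-forbidden? (parkingFunctions (suc m))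
  to-filter (isPF , avoids) =
    ∈-filter⁺ avoids-forbidden? (Equivalence.from ∈-parkingFunctions isPF) avoids
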